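{- For each integer $n\ge2$, the ascent generating polynomial of Riordan sequences $\mathrm{asc}_{\mathcal{RP}(n)}(t)=\sum_{\mathbf w\in\mathcal{RP}(n)}t^{\mathrm{asc}(\mathbf w)}$ satisfies $$\mathrm{asc}_{\mathcal{RP}(n)}(t)=\sum_{i=1}^{\lfloor (n-1)/2\rfloor}\frac1i\binom{n-1}{i-1}\binom{n-2-i}{i-1}t^i=t\cdot{}_3F_2\!\left(1-n,\frac{3-n}{2},\frac{4-n}{2};2,3-n;4t\right).$$
   Context: $\mathcal{RP}(n)$ is the set of Riordan sequences of size $n$: sequences $\mathbf w=(w_1,\dots,w_n)$ of positive integers with $w_1=w_n=1$, $|w_i-w_{i+1}|\le1$ for $1\le i<n$, and no index $i$ with $w_i=w_{i+1}=1$. $\mathrm{asc}(\mathbf w)$ is the number of indices $i\in\{1,\dots,n-1\}$ with $w_i<w_{i+1}$. ${}_3F_2(a_1,a_2,a_3;b_1,b_2;z)=\sum_{k\ge0}\frac{(a_1)_k(a_2)_k(a_3)_k}{(b_1)_k(b_2)_k}\frac{z^k}{k!}$ is the generalized hypergeometric function, where $(a)_k=a(a+1)\cdots(a+k-1)$.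
   Formalization: The hypergeometric equality is stated only for n ≥ 3: at n = 2 there are no Riordan sequences, so the polynomial is 0, but the right side is t − t². For n ≥ 3 the series is read as terminating, its 0/0 terms (k ≥ n−2) counted as 0. -}

module Defs where

open import Data.Nat as ℕ using (ℕ; zero; suc; _≤_; z≤n; s≤s; ∣_-_∣; _!)
import Data.Nat.Properties as ℕₚ
open import Data.Integer using (+_)
open import Data.Rational as ℚ using (ℚ; 0ℚ; 1ℚ; _/_; _÷_; ≢-nonZero)
open import Data.Fin using (Fin; zero; suc; inject₁; fromℕ; toℕ)
import Data.Fin.Properties as Finₚ
open import Data.Vec using (Vec; []; _∷_; lookup)
import Data.Vec.Properties as Vecₚ
open import Data.List
  using (List; []; _∷_; [_]; map; foldr; filter; length; upTo; allFin; cartesianProductWith)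
open import Data.List.Membership.Propositional using (_∈_)
import Data.List.Membership.Propositional.Properties as ∈ₚ
open import Data.List.Relation.Unary.Any using (here)
open import Data.List.Relation.Unary.All using ([])
open import Data.List.Relation.Unary.AllPairs using ([]; _∷_)
open import Data.List.Relation.Unary.Unique.Propositional using (Unique)
import Data.List.Relation.Unary.Unique.Propositional.Properties as Uniqueₚ
open import Data.Product using (_×_; _,_; proj₂)
open import Function.Bundles using (_⇔_; mk⇔)
open import Relation.Nullary using (¬_; Dec; yes; no; ¬?; _×-dec_)
open import Relation.Nullary.Decidable using (map′)
open import Relation.Binary.PropositionalEquality using (_≡_; refl; cong)

------------------------------------------------------------------------
-- Riordan sequences

-- The entries w_i, w_{i+1} (1 ≤ i < n) of a sequence of size n = suc m are
-- read off at inject₁ i and suc i for i : Fin m.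
record IsRiordan {m : ℕ} (w : Vec ℕ (suc m)) : Set where
  field
    positive : ∀ i → 1 ≤ lookup w i
    first    : lookup w zero ≡ 1
    last     : lookup w (fromℕ m) ≡ 1
    step     : ∀ (i : Fin m) → ∣ lookup w (inject₁ i) - lookup w (suc i) ∣ ≤ 1
    noFlat   : ∀ (i : Fin m) → ¬ (lookup w (inject₁ i) ≡ 1 × lookup w (suc i) ≡ 1)

isRiordan? : ∀ {m} (w : Vec ℕ (suc m)) → Dec (IsRiordan w)
isRiordan? {m} w = map′
  (λ (p , f , l , s , n) → record { positive = p ; first = f ; last = l ; step = s ; noFlat = n })
  (λ r → let open IsRiordan r in positive , first , last , step , noFlat)
  (Finₚ.all? (λ i → 1 ℕ.≤? lookup w i)
   ×-dec (lookup w zero ℕ.≟ 1)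
   ×-dec (lookup w (fromℕ m) ℕ.≟ 1)
   ×-dec Finₚ.all? (λ i → ∣ lookup w (inject₁ i) - lookup w (suc i) ∣ ℕ.≤? 1)
   ×-dec Finₚ.all? (λ i → ¬? ((lookup w (inject₁ i) ℕ.≟ 1) ×-dec (lookup w (suc i) ℕ.≟ 1))))

asc : ∀ {m} → Vec ℕ (suc m) → ℕ
asc {m} w = length (filter (λ i → lookup w (inject₁ i) ℕ.<? lookup w (suc i)) (allFin m))

vectorsOver : List ℕ → (n : ℕ) → List (Vec ℕ n)
vectorsOver xs zero    = [ [] ]
vectorsOver xs (suc n) = cartesianProductWith _∷_ xs (vectorsOver xs n)

-- RP m lists the Riordan sequences of size suc m.  Searching only among
-- entries in {1, …, suc m} loses nothing: see ∈-RP and RP-unique.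
RP : (m : ℕ) → List (Vec ℕ (suc m))
RP m = filter isRiordan? (vectorsOver (map suc (upTo (suc m))) (suc m))

∈-vectorsOver : ∀ {xs n} (w : Vec ℕ n) → (∀ i → lookup w i ∈ xs) → w ∈ vectorsOver xs n
∈-vectorsOver []      _ = here refl
∈-vectorsOver (x ∷ w) h =
  ∈ₚ.∈-cartesianProductWith⁺ _∷_ (h zero) (∈-vectorsOver w (λ i → h (suc i)))

vectorsOver-unique : ∀ {xs} → Unique xs → ∀ n → Unique (vectorsOver xs n)
vectorsOver-unique u zero    = [] ∷ []
vectorsOver-unique u (suc n) =
  Uniqueₚ.cartesianProductWith⁺ _∷_ Vecₚ.∷-injective u (vectorsOver-unique u n)

entry-bound : ∀ {m} (w : Vec ℕ (suc m)) →
  (∀ (i : Fin m) → ∣ lookup w (inject₁ i) - lookup w (suc i) ∣ ≤ 1) →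
  ∀ i → lookup w i ≤ toℕ i ℕ.+ lookup w zero
entry-bound w step zero = ℕₚ.≤-refl
entry-bound {suc m} (x ∷ y ∷ w) step (suc i) = begin
  lookup (y ∷ w) i          ≤⟨ entry-bound (y ∷ w) (λ j → step (suc j)) i ⟩
  toℕ i ℕ.+ y               ≤⟨ ℕₚ.+-monoʳ-≤ (toℕ i) (ℕₚ.m≤n+∣n-m∣ y x) ⟩
  toℕ i ℕ.+ (x ℕ.+ ∣ x - y ∣) ≤⟨ ℕₚ.+-monoʳ-≤ (toℕ i) (ℕₚ.+-monoʳ-≤ x (step zero)) ⟩
  toℕ i ℕ.+ (x ℕ.+ 1)       ≡⟨ cong (toℕ i ℕ.+_) (ℕₚ.+-comm x 1) ⟩
  toℕ i ℕ.+ suc x           ≡⟨ ℕₚ.+-suc (toℕ i) x ⟩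
  suc (toℕ i ℕ.+ x)         ∎
  where open ℕₚ.≤-Reasoning

∈-RP : ∀ {m} (w : Vec ℕ (suc m)) → w ∈ RP m ⇔ IsRiordan w
∈-RP {m} w = mk⇔
  (λ h → proj₂ (∈ₚ.∈-filter⁻ isRiordan? {xs = vectorsOver (map suc (upTo (suc m))) (suc m)} h))
  (λ r → ∈ₚ.∈-filter⁺ isRiordan? (∈-vectorsOver w (inRange r)) r)
  where
  mem : ∀ {x} → 1 ≤ x → x ≤ suc m → x ∈ map suc (upTo (suc m))
  mem {suc x} _ x≤ = ∈ₚ.∈-map⁺ suc (∈ₚ.∈-upTo⁺ x≤)

  inRange : IsRiordan w → ∀ i → lookup w i ∈ map suc (upTo (suc m))
  inRange r i = mem (positive i) (begin
    lookup w i               ≤⟨ entry-bound w step i ⟩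
    toℕ i ℕ.+ lookup w zero  ≡⟨ cong (toℕ i ℕ.+_) first ⟩
    toℕ i ℕ.+ 1              ≡⟨ ℕₚ.+-comm (toℕ i) 1 ⟩
    suc (toℕ i)              ≤⟨ Finₚ.toℕ<n i ⟩
    suc m                    ∎)
    where
    open ℕₚ.≤-Reasoning
    open IsRiordan r

RP-unique : ∀ m → Unique (RP m)
RP-unique m = Uniqueₚ.filter⁺ isRiordan?
  (vectorsOver-unique (Uniqueₚ.map⁺ ℕₚ.suc-injective (Uniqueₚ.upTo⁺ (suc m))) (suc m))

------------------------------------------------------------------------
-- Polynomials and power series in one variable over ℚ, given by their
-- coefficients; ℚ[t] is viewed inside ℚ[[t]].

ℚ[[t]] : Set
ℚ[[t]] = ℕ → ℚ

infix 4 _≈_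
_≈_ : ℚ[[t]] → ℚ[[t]] → Set
f ≈ g = ∀ k → f k ≡ g k

t^_ : ℕ → ℚ[[t]]
(t^ j) k with k ℕ.≟ j
... | yes _ = 1ℚ
... | no  _ = 0ℚ

infixr 7 _·_
_·_ : ℚ → ℚ[[t]] → ℚ[[t]]
(c · f) k = c ℚ.* f k

∑ : List ℚ[[t]] → ℚ[[t]]
∑ fs k = foldr (λ f s → f k ℚ.+ s) 0ℚ fs

∑[1⋯_] : (N : ℕ) → ((i : ℕ) → .{{ℕ.NonZero i}} → ℚ[[t]]) → ℚ[[t]]
∑[1⋯ N ] f = ∑ (map (λ j → f (suc j)) (upTo N))

infix 5 t*_
t*_ : ℚ[[t]] → ℚ[[t]]
(t* f) zero    = 0ℚ
(t* f) (suc k) = f k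

fromNat : ℕ → ℚ
fromNat n = + n / 1

-- There is no sequence of size 0 (w₁ would not exist).
ascRP : ℕ → ℚ[[t]]
ascRP zero    = ∑ []
ascRP (suc m) = ∑ (map (λ w → t^ asc w) (RP m))

------------------------------------------------------------------------
-- Hypergeometric series

infixr 8 _^_
_^_ : ℚ → ℕ → ℚ
c ^ zero  = 1ℚ
c ^ suc k = c ^ k ℚ.* c

poch : ℚ → ℕ → ℚ
poch a zero    = 1ℚ
poch a (suc k) = poch a k ℚ.* (a ℚ.+ fromNat k)

infixl 7 _÷₀_
_÷₀_ : ℚ → ℚ → ℚ
p ÷₀ q with q ℚ.≟ 0ℚ
... | yes _   = 0ℚ
... | no  q≢0 = _÷_ p q {{≢-nonZero q≢0}}

-- The series ₃F₂(a₁,a₂,a₃;b₁,b₂;z) at z = c t.  A terminating series may have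
-- b₁ or b₂ a non-positive integer provided a numerator parameter has already
-- made the terms vanish; the 0/0 terms beyond that point count as 0, which is
-- what _÷₀_ yields.  (For b₂ = 3 - n with n ≥ 3, (b₂)_k vanishes iff k ≥ n - 2,
-- whereas (3-n)/2 or (4-n)/2 makes the numerator vanish for k > ⌊(n-3)/2⌋.)
₃F₂[_,_,_⨾_,_⨾_t] : (a₁ a₂ a₃ b₁ b₂ c : ℚ) → ℚ[[t]]
₃F₂[ a₁ , a₂ , a₃ ⨾ b₁ , b₂ ⨾ c t] k =
  ((poch a₁ k ℚ.* poch a₂ k ℚ.* poch a₃ k) ÷₀ (poch b₁ k ℚ.* poch b₂ k))
    ℚ.* (c ^ k ÷₀ fromNat (k !))

-- At n = 2 no denominator vanishes and t ₃F₂(-1, 1/2, 1; 2, 1; 4t) = t - t²,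
-- although no Riordan sequence has size 2.  The hypergeometric form of the
-- ascent polynomial therefore requires n ≥ 3.
₃F₂-at-2 :
  (t* ₃F₂[ ℚ.- 1ℚ , + 1 / 2 , 1ℚ ⨾ fromNat 2 , 1ℚ ⨾ fromNat 4 t]) 1 ≡ 1ℚ ×
  (t* ₃F₂[ ℚ.- 1ℚ , + 1 / 2 , 1ℚ ⨾ fromNat 2 , 1ℚ ⨾ fromNat 4 t]) 2 ≡ ℚ.- 1ℚ
₃F₂-at-2 = refl , refl

RP-size-2 : RP 1 ≡ []
RP-size-2 = refl

{-# OPTIONS --safe #-}

-- A Riordan sequence of size m + 1 is a Motzkin path with m steps and no flat
-- step at height 0, up steps being the ascents.  If φ = 1 + u + t u², Lagrange
-- inversion predicts that the paths from height h to 0 with m steps and k up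
-- steps are counted by the coefficient of t^k u^(m - h) in
-- (1 - t u²) φ^m / (1 + u).  This difference of two products of binomials is
-- checked by induction on m: above height 0 the recursion is multiplication by
-- φ, and at height 0 it amounts to the symmetry of φ^m.  For h = 0 the
-- difference collapses to the stated product.  The hypergeometric terms follow
-- from 4^k (b/2)_k ((b+1)/2)_k = (b)_2k with b = 3 - n, and from
-- (-N)_k = (-1)^k k! C(N,k).
module Submission where

open import Defs
open import Data.Nat as ℕ using (ℕ; zero; suc; _≤_; _<_; _∸_; z≤n; s≤s; ∣_-_∣; _!; ⌊_/2⌋)
open import Data.Nat.Combinatorics using (_C_; nC1≡n; nCn≡1; k>n⇒nCk≡0; nCk+nC[k+1]≡[n+1]C[k+1])
open import Data.Nat.Tactic.RingSolver using (solve-∀)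
open import Data.Bool using (true; false)
open import Data.Fin using (Fin; zero; suc; inject₁; fromℕ)
open import Data.Vec using (Vec; []; _∷_; lookup)
import Data.Vec.Properties as Vecₚ
open import Data.List using (List; []; _∷_; [_]; _++_; map; concatMap; filter; length; allFin; tabulate; upTo)
import Data.List.Properties as Listₚ
open import Data.List.Membership.Propositional using (_∈_; _∉_; find; lose)
import Data.List.Membership.Propositional.Properties as ∈ₚ
open import Data.List.Membership.Propositional.Properties.WithK using (unique∧set⇒bag)
open import Data.List.Relation.Binary.BagAndSetEquality using (∼bag⇒↭)
open import Data.List.Relation.Binary.Disjoint.Propositional using (Disjoint)
open import Data.List.Relation.Binary.Permutation.Propositional using (_↭_)
open import Data.List.Relation.Binary.Permutation.Propositional.Properties using (↭-length; filter-↭)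
open import Data.List.Relation.Unary.All as All using (All; []; _∷_)
import Data.List.Relation.Unary.All.Properties as Allₚ
open import Data.List.Relation.Unary.AllPairs as AllPairs using ([]; _∷_)
import Data.List.Relation.Unary.AllPairs.Properties as AllPairsₚ
open import Data.List.Relation.Unary.Any using (here; there)
open import Data.List.Relation.Unary.Unique.Propositional using (Unique)
import Data.List.Relation.Unary.Unique.Propositional.Properties as Uniqueₚ
open import Data.Product using (_×_; _,_; ∃)
open import Data.Sum using (inj₁; inj₂; [_,_]′)
open import Function using (_∘_; id)
open import Function.Bundles using (mk⇔; Equivalence)
open import Relation.Nullary using (¬_; Dec; does; yes; no; contradiction)
open import Relation.Unary using (Decidable)
open import Relation.Binary.Definitions using (tri<; tri≈; tri>)
open import Relation.Binary.PropositionalEquality using (_≡_; _≢_; refl; sym; trans; cong; cong₂; subst; module ≡-Reasoning)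

open ≡-Reasoning

module Counting where

  open import Data.Nat using (_+_; _*_)
  open import Data.Nat.Properties

  -- Absorption identities for binomials and falling factorials.

  -- The absorption rule, multiplied out to avoid division; Pascal's rule gives it by induction on
  -- `n`.
  [1+k]*[1+n]C[1+k] : ∀ n k → suc k * (suc n C suc k) ≡ suc n * (n C k)
  [1+k]*[1+n]C[1+k] n       zero    = begin
    1 * (suc n C 1)  ≡⟨ *-identityˡ (suc n C 1) ⟩
    suc n C 1        ≡⟨ nC1≡n (suc n) ⟩
    suc n            ≡⟨ *-identityʳ (suc n) ⟨
    suc n * 1        ∎
  [1+k]*[1+n]C[1+k] zero    (suc k) = begin
    (2 + k) * (1 C (2 + k))  ≡⟨ cong ((2 + k) *_) (k>n⇒nCk≡0 {1} {2 + k} (s≤s (s≤s z≤n))) ⟩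
    (2 + k) * 0              ≡⟨ *-zeroʳ (2 + k) ⟩
    0                        ≡⟨ cong (1 *_) (k>n⇒nCk≡0 {0} {suc k} (s≤s z≤n)) ⟨
    1 * (0 C suc k)          ∎
  [1+k]*[1+n]C[1+k] (suc n) (suc k) = begin
    (2 + k) * ((2 + n) C (2 + k))
      ≡⟨ cong ((2 + k) *_) (nCk+nC[k+1]≡[n+1]C[k+1] (suc n) (suc k)) ⟨
    (2 + k) * (a + b)
      ≡⟨ expand k a b ⟩
    a + suc k * a + (2 + k) * b
      ≡⟨ cong₂ (λ x y → a + x + y) ([1+k]*[1+n]C[1+k] n k) ([1+k]*[1+n]C[1+k] n (suc k)) ⟩
    a + suc n * (n C k) + suc n * (n C suc k)
      ≡⟨ +-assoc a (suc n * (n C k)) _ ⟩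
    a + (suc n * (n C k) + suc n * (n C suc k))
      ≡⟨ cong (a +_) (*-distribˡ-+ (suc n) (n C k) (n C suc k)) ⟨
    a + suc n * (n C k + n C suc k)
      ≡⟨ cong (λ x → a + suc n * x) (nCk+nC[k+1]≡[n+1]C[k+1] n k) ⟩
    (2 + n) * a ∎
    where
    a = suc n C suc k
    b = suc n C (2 + k)
    expand : ∀ k a b → (2 + k) * (a + b) ≡ a + suc k * a + (2 + k) * b
    expand = solve-∀

  -- Pascal's rule splits the left side of the absorption rule, and `suc k * (n C k)` is cancelled.
  -- For `n < k` both sides vanish, so the truncation in `n ∸ k` does no harm.
  [1+k]*nC[1+k] : ∀ n k → suc k * (n C suc k) ≡ (n ∸ k) * (n C k)
  [1+k]*nC[1+k] n k with ≤-<-connex k n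
  ... | inj₂ n<k = begin
    suc k * (n C suc k)  ≡⟨ cong (suc k *_) (k>n⇒nCk≡0 (m<n⇒m<1+n n<k)) ⟩
    suc k * 0            ≡⟨ *-zeroʳ (suc k) ⟩
    0                    ≡⟨ cong (_* (n C k)) (m≤n⇒m∸n≡0 (<⇒≤ n<k)) ⟨
    (n ∸ k) * (n C k)    ∎
  ... | inj₁ k≤n = +-cancelˡ-≡ (suc k * (n C k)) _ _ (begin
    suc k * (n C k) + suc k * (n C suc k)  ≡⟨ *-distribˡ-+ (suc k) (n C k) (n C suc k) ⟨
    suc k * (n C k + n C suc k)            ≡⟨ cong (suc k *_) (nCk+nC[k+1]≡[n+1]C[k+1] n k) ⟩
    suc k * (suc n C suc k)                ≡⟨ [1+k]*[1+n]C[1+k] n k ⟩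
    suc n * (n C k)                        ≡⟨ cong (λ x → suc x * (n C k)) (m+[n∸m]≡n k≤n) ⟨
    (suc k + (n ∸ k)) * (n C k)            ≡⟨ *-distribʳ-+ (n C k) (suc k) (n ∸ k) ⟩
    suc k * (n C k) + (n ∸ k) * (n C k)    ∎)

  -- The falling factorial n (n - 1) ⋯ (n - k + 1), which is (-n)_k up to sign. Written through
  -- `_C_`, it unfolds to a binomial once Pochhammer symbols are gone.
  falling : ℕ → ℕ → ℕ
  falling n k = k ! * (n C k)

  falling-suc : ∀ n k → falling n (suc k) ≡ (n ∸ k) * falling n k
  falling-suc n k = begin
    suc k * k ! * (n C suc k)    ≡⟨ swap (suc k) (k !) (n C suc k) ⟩
    k ! * (suc k * (n C suc k))  ≡⟨ cong (k ! *_) ([1+k]*nC[1+k] n k) ⟩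
    k ! * ((n ∸ k) * (n C k))    ≡⟨ swap (n ∸ k) (k !) (n C k) ⟨
    (n ∸ k) * k ! * (n C k)      ≡⟨ *-assoc (n ∸ k) (k !) (n C k) ⟩
    (n ∸ k) * falling n k        ∎
    where
    swap : ∀ a b c → a * b * c ≡ b * (a * c)
    swap = solve-∀

  -- With `j = k` this turns a Pochhammer symbol of length 2k into two of length k, one of which
  -- cancels against the lower parameter 3 - n.
  falling-+ : ∀ n k j → falling n (j + k) ≡ falling n k * falling (n ∸ k) j
  falling-+ n k zero    = sym (*-identityʳ (falling n k))
  falling-+ n k (suc j) = begin
    falling n (suc (j + k))                            ≡⟨ falling-suc n (j + k) ⟩
    (n ∸ (j + k)) * falling n (j + k)                  ≡⟨ cong₂ _*_ (trans (cong (n ∸_) (+-comm j k)) (sym (∸-+-assoc n k j))) (falling-+ n k j) ⟩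
    (n ∸ k ∸ j) * (falling n k * falling (n ∸ k) j)    ≡⟨ swap (n ∸ k ∸ j) (falling n k) (falling (n ∸ k) j) ⟩
    falling n k * ((n ∸ k ∸ j) * falling (n ∸ k) j)    ≡⟨ cong (falling n k *_) (falling-suc (n ∸ k) j) ⟨
    falling n k * falling (n ∸ k) (suc j)              ∎
    where
    swap : ∀ a b c → a * (b * c) ≡ b * (a * c)
    swap = solve-∀

  n<k⇒falling≡0 : ∀ {n k} → n < k → falling n k ≡ 0
  n<k⇒falling≡0 {n} {k} n<k = trans (cong (k ! *_) (k>n⇒nCk≡0 n<k)) (*-zeroʳ (k !))

  k≤n⇒falling≢0 : ∀ {n k} → k ≤ n → falling n k ≢ 0
  k≤n⇒falling≢0 {n} {suc k} k<n eq with m*n≡0⇒m≡0∨n≡0 (n ∸ k) (trans (sym (falling-suc n k)) eq)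
  ... | inj₁ n∸k≡0 = m>n⇒m∸n≢0 k<n n∸k≡0
  ... | inj₂ f≡0   = k≤n⇒falling≢0 (<⇒≤ k<n) f≡0

  -- Coefficients of φ^m / (1 + u).

  -- Q n d is the coefficient of u^(n - d) in (1 + u)^n / (1 + u), the truncated
  -- form of which, C (n - 1) (d - 1), is wrong at n = 0 and at d = 0.
  Q : ℕ → ℕ → ℕ
  Q zero    zero    = 1
  Q zero    (suc d) = 0
  Q (suc n) zero    = 0
  Q (suc n) (suc d) = n C d

  -- Multiplication by 1 + u; the boundary values in `Q` make it hold for all `n` and `d`.
  Q-suc : ∀ n d → Q (suc n) (suc d) ≡ Q n d + Q n (suc d)
  Q-suc zero    zero    = refl
  Q-suc zero    (suc d) = k>n⇒nCk≡0 {0} {suc d} (s≤s z≤n)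
  Q-suc (suc n) zero    = refl
  Q-suc (suc n) (suc d) = sym (nCk+nC[k+1]≡[n+1]C[k+1] n d)

  n<d⇒Q≡0 : ∀ {n d} → n < d → Q n d ≡ 0
  n<d⇒Q≡0 {zero}  {suc d} _         = refl
  n<d⇒Q≡0 {suc n} {suc d} (s≤s n<d) = k>n⇒nCk≡0 n<d

  -- With φ = 1 + u + t u², F m k d and G m k d are the coefficients of
  -- t^k u^(m + k - d) in φ^m / (1 + u) and in t u² φ^m / (1 + u).
  F : ℕ → ℕ → ℕ → ℕ
  F m k d = (m C k) * Q (m ∸ k) d

  G : ℕ → ℕ → ℕ → ℕ
  G m zero    d = 0
  G m (suc k) d = F m k (suc d)

  -- For `k < m` this is `Q-suc` at `m ∸ suc k`. For `m ≤ k` truncation spoils that step, but the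
  -- binomial factor is zero.
  mC[1+k]*Q : ∀ m k d → (m C suc k) * Q (m ∸ k) (suc d) ≡ F m (suc k) d + F m (suc k) (suc d)
  mC[1+k]*Q m k d with <-≤-connex k m
  ... | inj₁ k<m = begin
    c * Q (m ∸ k) (suc d)                                 ≡⟨ cong (λ x → c * Q x (suc d)) (+-∸-assoc 1 k<m) ⟩
    c * Q (suc (m ∸ suc k)) (suc d)                       ≡⟨ cong (c *_) (Q-suc (m ∸ suc k) d) ⟩
    c * (Q (m ∸ suc k) d + Q (m ∸ suc k) (suc d))         ≡⟨ *-distribˡ-+ c _ _ ⟩
    F m (suc k) d + F m (suc k) (suc d)                   ∎
    where c = m C suc k
  ... | inj₂ m≤k rewrite k>n⇒nCk≡0 (s≤s m≤k) = refl

  -- Multiplication by φ: the three summands come from its terms t u², 1 and u, in this order.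
  F-suc : ∀ m k d → F (suc m) k (suc d) ≡ G m k d + F m k d + F m k (suc d)
  F-suc m zero    d = begin
    1 * Q (suc m) (suc d)           ≡⟨ *-identityˡ _ ⟩
    Q (suc m) (suc d)               ≡⟨ Q-suc m d ⟩
    Q m d + Q m (suc d)             ≡⟨ cong₂ _+_ (*-identityˡ (Q m d)) (*-identityˡ (Q m (suc d))) ⟨
    1 * Q m d + 1 * Q m (suc d)     ∎
  F-suc m (suc k) d = begin
    (suc m C suc k) * q                                        ≡⟨ cong (_* q) (nCk+nC[k+1]≡[n+1]C[k+1] m k) ⟨
    (m C k + m C suc k) * q                                    ≡⟨ *-distribʳ-+ q (m C k) (m C suc k) ⟩
    F m k (suc d) + (m C suc k) * q                            ≡⟨ cong (F m k (suc d) +_) (mC[1+k]*Q m k d) ⟩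
    F m k (suc d) + (F m (suc k) d + F m (suc k) (suc d))      ≡⟨ +-assoc (F m k (suc d)) _ _ ⟨
    F m k (suc d) + F m (suc k) d + F m (suc k) (suc d)        ∎
    where q = Q (m ∸ k) (suc d)

  -- The coefficients of t^k u^(m - 1) and of t^(k + 1) u^(m + 1) in φ^m agree
  -- because u ↦ 1 / (t u) multiplies φ by 1 / (t u²).
  F-reflect : ∀ m k → F m (suc k) k + F m (suc k) (suc k) ≡ F m k (suc k) + F m k (2 + k)
  F-reflect m k with <-cmp k m
  F-reflect m k | tri< k<m _ _ = *-cancelˡ-≡ _ _ (suc k) (begin
    suc k * (F m (suc k) k + F m (suc k) (suc k))     ≡⟨ cong (suc k *_) (mC[1+k]*Q m k k) ⟨
    suc k * ((m C suc k) * Q (m ∸ k) (suc k))         ≡⟨ cong (λ x → suc k * ((m C suc k) * Q x (suc k))) m∸k ⟩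
    suc k * ((m C suc k) * (p C k))                   ≡⟨ *-assoc (suc k) (m C suc k) (p C k) ⟨
    suc k * (m C suc k) * (p C k)                     ≡⟨ cong (_* (p C k)) ([1+k]*nC[1+k] m k) ⟩
    (m ∸ k) * (m C k) * (p C k)                       ≡⟨ cong (λ x → x * (m C k) * (p C k)) m∸k ⟩
    suc p * (m C k) * (p C k)                         ≡⟨ swap (suc p) (m C k) (p C k) ⟩
    (m C k) * (suc p * (p C k))                       ≡⟨ cong ((m C k) *_) ([1+k]*[1+n]C[1+k] p k) ⟨
    (m C k) * (suc k * (suc p C suc k))               ≡⟨ swap (suc k) (m C k) (suc p C suc k) ⟨
    suc k * (m C k) * (suc p C suc k)                 ≡⟨ *-assoc (suc k) (m C k) (suc p C suc k) ⟩
    suc k * ((m C k) * (suc p C suc k))               ≡⟨ cong (λ x → suc k * ((m C k) * x)) (Q-suc (suc p) (suc k)) ⟩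
    suc k * ((m C k) * (Q (suc p) (suc k) + Q (suc p) (2 + k)))
      ≡⟨ cong (suc k *_) (*-distribˡ-+ (m C k) _ _) ⟩
    suc k * ((m C k) * Q (suc p) (suc k) + (m C k) * Q (suc p) (2 + k))
      ≡⟨ cong (λ x → suc k * ((m C k) * Q x (suc k) + (m C k) * Q x (2 + k))) m∸k ⟨
    suc k * (F m k (suc k) + F m k (2 + k))           ∎)
    where
    p = m ∸ suc k
    m∸k : m ∸ k ≡ suc p
    m∸k = +-∸-assoc 1 k<m
    swap : ∀ a b c → a * b * c ≡ b * (a * c)
    swap = solve-∀
  F-reflect m k | tri≈ _ refl _ rewrite k>n⇒nCk≡0 (n<1+n m) | nCn≡1 m | n∸n≡0 m = refl
  F-reflect m k | tri> _ _ m<k rewrite k>n⇒nCk≡0 (m<n⇒m<1+n m<k) | k>n⇒nCk≡0 m<k = refl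

  -- Recursive enumeration of lattice paths.

  -- A Riordan sequence is read as a lattice path whose height h at an entry
  -- suc h starts and ends at 0; nextHeights h are the heights one step away.
  nextHeights : ℕ → List ℕ
  nextHeights zero    = 1 ∷ []
  nextHeights (suc h) = 2 + h ∷ suc h ∷ h ∷ []

  paths : (m h : ℕ) → List (Vec ℕ (suc m))
  paths zero    zero    = [ 1 ∷ [] ]
  paths zero    (suc h) = []
  paths (suc m) h       = map (suc h ∷_) (concatMap (paths m) (nextHeights h))

  -- Freeing the starting height puts the tail of a Riordan sequence under the same predicate, which
  -- induction on the length requires.
  record IsPath (h : ℕ) {m : ℕ} (w : Vec ℕ (suc m)) : Set where
    field
      positive : ∀ i → 1 ≤ lookup w i
      first    : lookup w zero ≡ suc h
      last     : lookup w (fromℕ m) ≡ 1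
      step     : ∀ (i : Fin m) → ∣ lookup w (inject₁ i) - lookup w (suc i) ∣ ≤ 1
      noFlat   : ∀ (i : Fin m) → ¬ (lookup w (inject₁ i) ≡ 1 × lookup w (suc i) ≡ 1)

  ∣1+n-n∣≡1 : ∀ n → ∣ suc n - n ∣ ≡ 1
  ∣1+n-n∣≡1 zero    = refl
  ∣1+n-n∣≡1 (suc n) = ∣1+n-n∣≡1 n

  nextHeights-sound : ∀ {h h′} → h′ ∈ nextHeights h →
    ∣ suc h - suc h′ ∣ ≤ 1 × ¬ (suc h ≡ 1 × suc h′ ≡ 1)
  nextHeights-sound {zero}  (here refl)                 = s≤s z≤n , λ ()
  nextHeights-sound {suc h} (here refl)                 =
    ≤-reflexive (trans (∣-∣-comm h (suc h)) (∣1+n-n∣≡1 h)) , λ ()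
  nextHeights-sound {suc h} (there (here refl))         =
    ≤-trans (≤-reflexive (∣n-n∣≡0 h)) z≤n , λ ()
  nextHeights-sound {suc h} (there (there (here refl))) =
    ≤-reflexive (∣1+n-n∣≡1 h) , λ ()

  nextHeights-complete : ∀ h h′ → ∣ suc h - suc h′ ∣ ≤ 1 → ¬ (suc h ≡ 1 × suc h′ ≡ 1) →
    h′ ∈ nextHeights h
  nextHeights-complete zero    zero           _        n = contradiction (refl , refl) n
  nextHeights-complete zero    (suc zero)     _        _ = here refl
  nextHeights-complete zero    (suc (suc h′)) (s≤s ()) _
  nextHeights-complete (suc h) h′             s        _ = near h h′ s
    where
    near : ∀ h h′ → ∣ suc h - h′ ∣ ≤ 1 → h′ ∈ 2 + h ∷ suc h ∷ h ∷ []
    near zero    zero                s = there (there (here refl))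
    near (suc h) zero                (s≤s ())
    near zero    (suc zero)          s = there (here refl)
    near zero    (suc (suc zero))    s = here refl
    near zero    (suc (suc (suc _))) (s≤s ())
    near (suc h) (suc h′)            s with near h h′ s
    ... | here p                 = here (cong suc p)
    ... | there (here p)         = there (here (cong suc p))
    ... | there (there (here p)) = there (there (here (cong suc p)))

  isPath-∷⁺ : ∀ {h m h′} {w : Vec ℕ (suc m)} → h′ ∈ nextHeights h → IsPath h′ w →
    IsPath h (suc h ∷ w)
  isPath-∷⁺ {h} h′∈ r with nextHeights-sound h′∈
  ... | s , n = record
    { positive = λ { zero → s≤s z≤n ; (suc i) → positive i }
    ; first    = refl
    ; last     = last
    ; step     = λ { zero    → subst (λ x → ∣ suc h - x ∣ ≤ 1) (sym first) s
                   ; (suc i) → step i }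
    ; noFlat   = λ { zero (p , q) → n (p , trans (sym first) q)
                   ; (suc i)      → noFlat i }
    }
    where open IsPath r

  isPath-∷⁻ : ∀ {h m} {w : Vec ℕ (suc m)} → IsPath h (suc h ∷ w) →
    ∃ λ h′ → h′ ∈ nextHeights h × IsPath h′ w
  isPath-∷⁻ {h} {w = zero ∷ w}   r with () ← IsPath.positive r (suc zero)
  isPath-∷⁻ {h} {w = suc h′ ∷ w} r =
    h′ , nextHeights-complete h h′ (step zero) (noFlat zero) , record
      { positive = positive ∘ suc
      ; first    = refl
      ; last     = last
      ; step     = step ∘ suc
      ; noFlat   = noFlat ∘ suc
      }
    where open IsPath r

  paths-sound : ∀ m h {w} → w ∈ paths m h → IsPath h w
  paths-sound zero zero (here refl) = record
    { positive = λ { zero → s≤s z≤n }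
    ; first    = refl
    ; last     = refl
    ; step     = λ ()
    ; noFlat   = λ ()
    }
  paths-sound (suc m) h w∈ with ∈ₚ.∈-map⁻ (suc h ∷_) w∈
  ... | v , v∈ , refl with find (∈ₚ.∈-concatMap⁻ (paths m) {xs = nextHeights h} v∈)
  ...   | h′ , h′∈ , v∈′ = isPath-∷⁺ h′∈ (paths-sound m h′ v∈′)

  paths-complete : ∀ m h {w} → IsPath h w → w ∈ paths m h
  paths-complete zero    zero    {x ∷ []} r with refl ← IsPath.first r = here refl
  paths-complete zero    (suc h) {x ∷ []} r =
    contradiction (trans (sym (IsPath.first r)) (IsPath.last r)) λ ()
  paths-complete (suc m) h {x ∷ w}  r with refl ← IsPath.first r with isPath-∷⁻ r
  ... | h′ , h′∈ , r′ = ∈ₚ.∈-map⁺ (suc h ∷_)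
    (∈ₚ.∈-concatMap⁺ (paths m) (lose h′∈ (paths-complete m h′ r′)))

  nextHeights-unique : ∀ h → Unique (nextHeights h)
  nextHeights-unique zero    = [] ∷ []
  nextHeights-unique (suc h) =
    ((λ ()) ∷ (λ ()) ∷ []) ∷ ((λ ()) ∷ []) ∷ [] ∷ []

  paths-unique : ∀ m h → Unique (paths m h)
  paths-unique zero    zero    = [] ∷ []
  paths-unique zero    (suc h)   = []
  paths-unique (suc m) h = Uniqueₚ.map⁺ Vecₚ.∷-injectiveʳ
    (Uniqueₚ.concat⁺
      (Allₚ.map⁺ (All.universal (λ h′ → paths-unique m h′) (nextHeights h)))
      (AllPairsₚ.map⁺ (AllPairs.map disjoint (nextHeights-unique h))))
    where
    -- The first entry of a path recovers its starting height.
    disjoint : ∀ {h₁ h₂} → h₁ ≢ h₂ → Disjoint (paths m h₁) (paths m h₂)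
    disjoint h₁≢h₂ (v∈₁ , v∈₂) = h₁≢h₂ (suc-injective
      (trans (sym (IsPath.first (paths-sound m _ v∈₁))) (IsPath.first (paths-sound m _ v∈₂))))

  -- Two duplicate-free lists with the same members are permutations of each other, so any count
  -- over `RP m` may be taken over the recursive list.
  RP↭paths : ∀ m → RP m ↭ paths m 0
  RP↭paths m = ∼bag⇒↭ (unique∧set⇒bag (RP-unique m) (paths-unique m 0) (mk⇔
    (λ w∈ → paths-complete m 0 (toPath (Equivalence.to (∈-RP _) w∈)))
    (λ w∈ → Equivalence.from (∈-RP _) (fromPath (paths-sound m 0 w∈)))))
    where
    toPath : ∀ {w} → IsRiordan {m} w → IsPath 0 w
    toPath r = record { IsRiordan r }

    fromPath : ∀ {w} → IsPath 0 w → IsRiordan {m} w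
    fromPath r = record { IsPath r }

  paths-first : ∀ m h → All (λ w → lookup w zero ≡ suc h) (paths m h)
  paths-first m h = All.tabulate (λ w∈ → IsPath.first (paths-sound m h w∈))

  -- Effect of a first step on the number of ascents.

  length-filter-map : ∀ {A B : Set} {P : B → Set} (P? : Decidable P) (f : A → B) xs →
    length (filter P? (map f xs)) ≡ length (filter (P? ∘ f) xs)
  length-filter-map P? f []       = refl
  length-filter-map P? f (x ∷ xs) with does (P? (f x))
  ... | true  = cong suc (length-filter-map P? f xs)
  ... | false = length-filter-map P? f xs

  -- `allFin (suc m)` is `zero` followed by `tabulate suc`; reindexing along `suc` identifies the
  -- later positions with those of `w`.
  asc-tail : ∀ {m} x (w : Vec ℕ (suc m)) →
    length (filter (λ i → lookup (x ∷ w) (inject₁ i) ℕ.<? lookup (x ∷ w) (suc i)) (tabulate {n = m} suc))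
      ≡ asc w
  asc-tail {m} x w = trans
    (cong (length ∘ filter ascent?) (sym (Listₚ.map-tabulate {n = m} id suc)))
    (length-filter-map ascent? suc (allFin m))
    where
    ascent? : Decidable (λ i → lookup (x ∷ w) (inject₁ i) < lookup (x ∷ w) (suc i))
    ascent? i = lookup (x ∷ w) (inject₁ i) ℕ.<? lookup (x ∷ w) (suc i)

  asc-∷-< : ∀ {m x} (w : Vec ℕ (suc m)) → x < lookup w zero → asc (x ∷ w) ≡ suc (asc w)
  asc-∷-< {x = x} w x<w = trans
    (cong length (Listₚ.filter-accept (λ i → lookup (x ∷ w) (inject₁ i) ℕ.<? lookup (x ∷ w) (suc i)) x<w))
    (cong suc (asc-tail x w))

  asc-∷-≥ : ∀ {m x} (w : Vec ℕ (suc m)) → lookup w zero ≤ x → asc (x ∷ w) ≡ asc w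
  asc-∷-≥ {x = x} w w≤x = trans
    (cong length (Listₚ.filter-reject (λ i → lookup (x ∷ w) (inject₁ i) ℕ.<? lookup (x ∷ w) (suc i)) (≤⇒≯ w≤x)))
    (asc-tail x w)

  #asc : ∀ {m} → ℕ → List (Vec ℕ (suc m)) → ℕ
  #asc k ws = length (filter (λ w → asc w ℕ.≟ k) ws)

  #asc-++ : ∀ {m} k (vs ws : List (Vec ℕ (suc m))) → #asc k (vs ++ ws) ≡ #asc k vs + #asc k ws
  #asc-++ k vs ws = trans (cong length (Listₚ.filter-++ (λ w → asc w ℕ.≟ k) vs ws)) (Listₚ.length-++ (filter (λ w → asc w ℕ.≟ k) vs))

  module _ {m x : ℕ} where

    #asc-<-zero : ∀ {ws : List (Vec ℕ (suc m))} → All (λ w → x < lookup w zero) ws →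
      #asc 0 (map (x ∷_) ws) ≡ 0
    #asc-<-zero         []           = refl
    #asc-<-zero {w ∷ _} (x<w ∷ x<ws) rewrite asc-∷-< w x<w = #asc-<-zero x<ws

    #asc-<-suc : ∀ k {ws : List (Vec ℕ (suc m))} → All (λ w → x < lookup w zero) ws →
      #asc (suc k) (map (x ∷_) ws) ≡ #asc k ws
    #asc-<-suc k         []           = refl
    -- The Boolean of `suc (asc w) ≟ suc k` computes to `asc w ≡ᵇ k`, so one abstraction reduces the
    -- filters on both sides.
    #asc-<-suc k {w ∷ _} (x<w ∷ x<ws) rewrite asc-∷-< w x<w with asc w ℕ.≡ᵇ k
    ... | true  = cong suc (#asc-<-suc k x<ws)
    ... | false = #asc-<-suc k x<ws

    #asc-≥ : ∀ k {ws : List (Vec ℕ (suc m))} → All (λ w → lookup w zero ≤ x) ws →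
      #asc k (map (x ∷_) ws) ≡ #asc k ws
    #asc-≥ k         []           = refl
    #asc-≥ k {w ∷ _} (w≤x ∷ ws≤x) rewrite asc-∷-≥ w w≤x with asc w ℕ.≡ᵇ k
    ... | true  = cong suc (#asc-≥ k ws≤x)
    ... | false = #asc-≥ k ws≤x

  #paths : ℕ → ℕ → ℕ → ℕ
  #paths m h k = #asc k (paths m h)

  module _ (m h : ℕ) where

    paths-> : All (λ w → suc h < lookup w zero) (paths m (suc h))
    paths-> = All.map (≤-reflexive ∘ sym) (paths-first m (suc h))

    paths-≤ : ∀ {h′} → h′ ≤ h → All (λ w → lookup w zero ≤ suc h) (paths m h′)
    paths-≤ h′≤h = All.map (λ p → ≤-trans (≤-reflexive p) (s≤s h′≤h)) (paths-first m _)

  #paths-suc-zero-zero : ∀ m → #paths (suc m) 0 0 ≡ 0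
  #paths-suc-zero-zero m
    rewrite Listₚ.++-identityʳ (paths m 1) = #asc-<-zero (paths-> m 0)

  #paths-suc-zero-suc : ∀ m k → #paths (suc m) 0 (suc k) ≡ #paths m 1 k
  #paths-suc-zero-suc m k
    rewrite Listₚ.++-identityʳ (paths m 1) = #asc-<-suc k (paths-> m 0)

  -- The summand of the up step is left unevaluated: it is 0 at `k = 0` and otherwise counts paths
  -- with one ascent fewer.
  #paths-suc-suc : ∀ m h k → #paths (suc m) (suc h) k ≡
    #asc k (map (2 + h ∷_) (paths m (2 + h))) + (#paths m (suc h) k + #paths m h k)
  #paths-suc-suc m h k = begin
    #asc k (map f (up ++ level ++ down ++ []))
      ≡⟨ cong (λ ws → #asc k (map f (up ++ level ++ ws))) (Listₚ.++-identityʳ down) ⟩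
    #asc k (map f (up ++ level ++ down))
      ≡⟨ cong (#asc k) (Listₚ.map-++ f up (level ++ down)) ⟩
    #asc k (map f up ++ map f (level ++ down))
      ≡⟨ #asc-++ k (map f up) _ ⟩
    #asc k (map f up) + #asc k (map f (level ++ down))
      ≡⟨ cong (λ ws → #asc k (map f up) + #asc k ws) (Listₚ.map-++ f level down) ⟩
    #asc k (map f up) + #asc k (map f level ++ map f down)
      ≡⟨ cong (#asc k (map f up) +_) (#asc-++ k (map f level) _) ⟩
    #asc k (map f up) + (#asc k (map f level) + #asc k (map f down))
      ≡⟨ cong₂ (λ x y → #asc k (map f up) + (x + y))
           (#asc-≥ k (paths-≤ m (suc h) ≤-refl)) (#asc-≥ k (paths-≤ m (suc h) (n≤1+n h))) ⟩
    #asc k (map f up) + (#paths m (suc h) k + #paths m h k) ∎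
    where
    f     = 2 + h ∷_
    up    = paths m (2 + h)
    level = paths m (suc h)
    down  = paths m h

  -- Closed form of the path counts.

  F-zero : ∀ k d → F 0 k (suc d) ≡ 0
  F-zero k d = trans (cong (λ x → (0 C k) * Q x (suc d)) (0∸n≡0 k)) (*-zeroʳ (0 C k))

  -- The coefficient formula, stated additively to avoid truncated subtraction; `d = k + h` picks
  -- out the power u^(m - h). Above height 0 the up, level and down steps match the terms t u², u
  -- and 1 of φ in `F-suc`.
  #paths+G≡F : ∀ m h k → #paths m h k + G m k (k + h) ≡ F m k (k + h)
  #paths+G≡F zero    zero    zero    = refl
  #paths+G≡F zero    (suc h) zero    = refl
  #paths+G≡F zero    zero    (suc k) = F-zero k (suc k + 0)
  #paths+G≡F zero    (suc h) (suc k) = F-zero k (suc k + suc h)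
  #paths+G≡F (suc m) zero    zero    = cong (_+ 0) (#paths-suc-zero-zero m)
  #paths+G≡F (suc m) zero    (suc k) rewrite +-identityʳ k = begin
    #paths (suc m) 0 (suc k) + F (suc m) k (2 + k)
      ≡⟨ cong₂ _+_ (#paths-suc-zero-suc m k) (F-suc m k (suc k)) ⟩
    c + (G m k (suc k) + F m k (suc k) + F m k (2 + k))
      ≡⟨ regroup c (G m k (suc k)) (F m k (suc k)) (F m k (2 + k)) ⟩
    c + G m k (suc k) + (F m k (suc k) + F m k (2 + k))
      -- From height 0 only the up step exists, and the hypothesis at height 1 accounts for the t u²
      -- terms. What the terms 1 and u contribute to both sides balances by `F-reflect`.
      ≡⟨ cong₂ _+_ (subst (λ d → c + G m k d ≡ F m k d) (+-comm k 1) (#paths+G≡F m 1 k)) (sym (F-reflect m k)) ⟩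
    F m k (suc k) + (F m (suc k) k + F m (suc k) (suc k))
      ≡⟨ +-assoc (F m k (suc k)) _ _ ⟨
    F m k (suc k) + F m (suc k) k + F m (suc k) (suc k)
      ≡⟨ F-suc m (suc k) k ⟨
    F (suc m) (suc k) (suc k) ∎
    where
    c = #paths m 1 k
    regroup : ∀ a b c d → a + (b + c + d) ≡ a + b + (c + d)
    regroup = solve-∀
  #paths+G≡F (suc m) (suc h) zero    = begin
    #paths (suc m) (suc h) 0 + 0
      ≡⟨ +-identityʳ _ ⟩
    #paths (suc m) (suc h) 0
      ≡⟨ #paths-suc-suc m h 0 ⟩
    #asc 0 (map (2 + h ∷_) (paths m (2 + h))) + (#paths m (suc h) 0 + #paths m h 0)
      ≡⟨ cong₂ _+_ (#asc-<-zero (paths-> m (suc h))) (+-comm (#paths m (suc h) 0) _) ⟩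
    #paths m h 0 + #paths m (suc h) 0
      ≡⟨ cong₂ _+_ (trans (sym (+-identityʳ _)) (#paths+G≡F m h 0)) (trans (sym (+-identityʳ _)) (#paths+G≡F m (suc h) 0)) ⟩
    F m 0 h + F m 0 (suc h)
      ≡⟨ F-suc m 0 h ⟨
    F (suc m) 0 (suc h) ∎
  #paths+G≡F (suc m) (suc h) (suc k) rewrite +-suc k h = begin
    #paths (suc m) (suc h) (suc k) + F (suc m) k (3 + (k + h))
      ≡⟨ cong₂ _+_ (#paths-suc-suc m h (suc k)) (F-suc m k (2 + (k + h))) ⟩
    #asc (suc k) (map (2 + h ∷_) (paths m (2 + h))) + (level + down) + (G m k (2 + (k + h)) + F m k (2 + (k + h)) + F m k (3 + (k + h)))
      ≡⟨ cong (λ x → x + (level + down) + (G m k (2 + (k + h)) + F m k (2 + (k + h)) + F m k (3 + (k + h)))) (#asc-<-suc k (paths-> m (suc h))) ⟩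
    up + (level + down) + (G m k (2 + (k + h)) + F m k (2 + (k + h)) + F m k (3 + (k + h)))
      ≡⟨ regroup up level down (G m k (2 + (k + h))) (F m k (2 + (k + h))) (F m k (3 + (k + h))) ⟩
    up + G m k (2 + (k + h)) + (down + F m k (2 + (k + h))) + (level + F m k (3 + (k + h)))
      ≡⟨ cong₂ _+_ (cong₂ _+_
          (subst (λ d → up + G m k d ≡ F m k d) (trans (+-suc k (suc h)) (cong suc (+-suc k h))) (#paths+G≡F m (2 + h) k))
          (#paths+G≡F m h (suc k)))
          (subst (λ d → level + G m (suc k) d ≡ F m (suc k) d) (cong suc (+-suc k h)) (#paths+G≡F m (suc h) (suc k))) ⟩
    G m (suc k) (suc (k + h)) + F m (suc k) (suc (k + h)) + F m (suc k) (2 + (k + h))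
      ≡⟨ F-suc m (suc k) (suc (k + h)) ⟨
    F (suc m) (suc k) (2 + (k + h)) ∎
    where
    up    = #paths m (2 + h) k
    level = #paths m (suc h) (suc k)
    down  = #paths m h (suc k)
    regroup : ∀ u l d x y z → u + (l + d) + (x + y + z) ≡ u + x + (d + y) + (l + z)
    regroup = solve-∀

  -- Put m = M + 2 and p = M - k. By absorption `suc k` times `F` is (p + 2) C(m,k) C(p,k), and
  -- `suc k` times `G` is (p + 1) C(m,k) C(p,k), so their difference is a single product.
  [1+k]*#paths : ∀ M k → suc k * #paths (2 + M) 0 (suc k) ≡ ((2 + M) C k) * ((M ∸ k) C k)
  [1+k]*#paths M k with ≤-<-connex k M
  ... | inj₁ k≤M = +-cancelʳ-≡ (suc k * ((m C k) * (suc p C suc k))) _ _ (begin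
    suc k * c + suc k * ((m C k) * (suc p C suc k))
      ≡⟨ *-distribˡ-+ (suc k) c _ ⟨
    suc k * (c + (m C k) * (suc p C suc k))
      ≡⟨ cong (λ x → suc k * (c + (m C k) * Q x (2 + k))) m∸k ⟨
    suc k * (c + F m k (2 + k))
      ≡⟨ cong (suc k *_) (subst (λ d → c + F m k (suc d) ≡ F m (suc k) d) (cong suc (+-identityʳ k)) (#paths+G≡F m 0 (suc k))) ⟩
    suc k * ((m C suc k) * Q (suc M ∸ k) (suc k))
      ≡⟨ cong (λ x → suc k * ((m C suc k) * Q x (suc k))) (+-∸-assoc 1 k≤M) ⟩
    suc k * ((m C suc k) * (p C k))
      ≡⟨ *-assoc (suc k) (m C suc k) _ ⟨
    suc k * (m C suc k) * (p C k)
      ≡⟨ cong (_* (p C k)) ([1+k]*nC[1+k] m k) ⟩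
    (m ∸ k) * (m C k) * (p C k)
      ≡⟨ cong (λ x → x * (m C k) * (p C k)) m∸k ⟩
    (2 + p) * (m C k) * (p C k)
      ≡⟨ regroup p (m C k) (p C k) ⟩
    (m C k) * (p C k) + (m C k) * (suc p * (p C k))
      ≡⟨ cong (λ x → (m C k) * (p C k) + (m C k) * x) ([1+k]*[1+n]C[1+k] p k) ⟨
    (m C k) * (p C k) + (m C k) * (suc k * (suc p C suc k))
      ≡⟨ cong ((m C k) * (p C k) +_) (swap (m C k) (suc k) _) ⟩
    (m C k) * (p C k) + suc k * ((m C k) * (suc p C suc k)) ∎)
    where
    m = 2 + M
    p = M ∸ k
    c = #paths m 0 (suc k)
    m∸k : m ∸ k ≡ 2 + p
    m∸k = +-∸-assoc 2 k≤M
    regroup : ∀ p a b → (2 + p) * a * b ≡ a * b + a * (suc p * b)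
    regroup = solve-∀
    swap : ∀ a b c → a * (b * c) ≡ b * (a * c)
    swap = solve-∀
  -- Here `M ∸ k` is 0 and `k` is positive, so the right side vanishes; the count is bounded by `F`,
  -- which vanishes too.
  ... | inj₂ M<k = begin
    suc k * c                ≡⟨ cong (suc k *_) (n≤0⇒n≡0 c≤0) ⟩
    suc k * 0                ≡⟨ *-zeroʳ (suc k) ⟩
    0                        ≡⟨ *-zeroʳ (m C k) ⟨
    (m C k) * 0              ≡⟨ cong ((m C k) *_) (k>n⇒nCk≡0 (subst (_< k) (sym (m≤n⇒m∸n≡0 (<⇒≤ M<k))) (≤-<-trans z≤n M<k))) ⟨
    (m C k) * ((M ∸ k) C k)  ∎
    where
    m = 2 + M
    c = #paths m 0 (suc k)
    F≡0 : F m (suc k) (suc k + 0) ≡ 0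
    F≡0 = trans (cong (λ x → (m C suc k) * Q x (suc k + 0)) (m≤n⇒m∸n≡0 M<k)) (*-zeroʳ (m C suc k))
    c≤0 : c ≤ 0
    c≤0 = subst (c ≤_) (trans (#paths+G≡F m 0 (suc k)) F≡0) (m≤m+n c _)

open Counting
import Data.Nat.Properties as ℕₚ
open import Data.Integer as ℤ using (+_)
import Data.Integer.Properties as ℤₚ
open import Data.Integer.Tactic.RingSolver using () renaming (solve-∀ to ℤ-solve-∀)
open import Data.Rational using (ℚ; 0ℚ; 1ℚ; _/_; _*_; _+_; -_; 1/_; fromℚᵘ; toℚᵘ; ≢-nonZero)
open import Data.Rational.Properties
open import Data.Rational.Solver using (module +-*-Solver)
open import Data.Rational.Unnormalised as ℚᵘ using (mkℚᵘ; *≡*)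
import Data.Rational.Unnormalised.Properties as ℚᵘₚ
open +-*-Solver using (solve; _:+_; _:*_; :-_; con; _:=_)

-- Arithmetic of fractions.

-- A fraction `i / d` is reduced by a gcd and does not compute on variables. Seen as the image of an
-- unnormalised fraction, it obeys identities that cross-multiplication turns into integer ones.
fromℚᵘ-homo-+ : ∀ p q → fromℚᵘ p + fromℚᵘ q ≡ fromℚᵘ (p ℚᵘ.+ q)
fromℚᵘ-homo-+ p q = toℚᵘ-injective (≃R.begin
  toℚᵘ (fromℚᵘ p + fromℚᵘ q)             ≃R.≈⟨ toℚᵘ-homo-+ (fromℚᵘ p) (fromℚᵘ q) ⟩
  toℚᵘ (fromℚᵘ p) ℚᵘ.+ toℚᵘ (fromℚᵘ q)   ≃R.≈⟨ ℚᵘₚ.+-cong (toℚᵘ-fromℚᵘ p) (toℚᵘ-fromℚᵘ q) ⟩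
  p ℚᵘ.+ q                               ≃R.≈⟨ toℚᵘ-fromℚᵘ (p ℚᵘ.+ q) ⟨
  toℚᵘ (fromℚᵘ (p ℚᵘ.+ q))               ≃R.∎)
  where
  import Relation.Binary.Reasoning.Setoid ℚᵘₚ.≃-setoid as ≃R

fromℚᵘ-homo-* : ∀ p q → fromℚᵘ p * fromℚᵘ q ≡ fromℚᵘ (p ℚᵘ.* q)
fromℚᵘ-homo-* p q = toℚᵘ-injective (≃R.begin
  toℚᵘ (fromℚᵘ p * fromℚᵘ q)             ≃R.≈⟨ toℚᵘ-homo-* (fromℚᵘ p) (fromℚᵘ q) ⟩
  toℚᵘ (fromℚᵘ p) ℚᵘ.* toℚᵘ (fromℚᵘ q)   ≃R.≈⟨ ℚᵘₚ.*-cong (toℚᵘ-fromℚᵘ p) (toℚᵘ-fromℚᵘ q) ⟩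
  p ℚᵘ.* q                               ≃R.≈⟨ toℚᵘ-fromℚᵘ (p ℚᵘ.* q) ⟨
  toℚᵘ (fromℚᵘ (p ℚᵘ.* q))               ≃R.∎)
  where
  import Relation.Binary.Reasoning.Setoid ℚᵘₚ.≃-setoid as ≃R

/1-+ : ∀ i j → i / 1 + j / 1 ≡ (i ℤ.+ j) / 1
/1-+ i j = trans (fromℚᵘ-homo-+ (mkℚᵘ i 0) (mkℚᵘ j 0))
  (fromℚᵘ-cong {mkℚᵘ i 0 ℚᵘ.+ mkℚᵘ j 0} {mkℚᵘ (i ℤ.+ j) 0} (*≡* (eq i j)))
  where
  eq : ∀ i j → (i ℤ.* + 1 ℤ.+ j ℤ.* + 1) ℤ.* + 1 ≡ (i ℤ.+ j) ℤ.* + 1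
  eq = ℤ-solve-∀

/2-+ : ∀ i → i / 2 + i / 2 ≡ i / 1
/2-+ i = trans (fromℚᵘ-homo-+ (mkℚᵘ i 1) (mkℚᵘ i 1))
  (fromℚᵘ-cong {mkℚᵘ i 1 ℚᵘ.+ mkℚᵘ i 1} {mkℚᵘ i 0} (*≡* (eq i)))
  where
  eq : ∀ i → (i ℤ.* + 2 ℤ.+ i ℤ.* + 2) ℤ.* + 1 ≡ i ℤ.* + 4
  eq = ℤ-solve-∀

fromNat-+ : ∀ a b → fromNat (a ℕ.+ b) ≡ fromNat a + fromNat b
fromNat-+ a b = sym (/1-+ (+ a) (+ b))

fromNat-* : ∀ a b → fromNat (a ℕ.* b) ≡ fromNat a * fromNat b
fromNat-* a b = sym (trans (fromℚᵘ-homo-* (mkℚᵘ (+ a) 0) (mkℚᵘ (+ b) 0))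
  (cong (_/ 1) (sym (ℤₚ.pos-* a b))))

fromNat-≢0 : ∀ {a} → a ≢ 0 → fromNat a ≢ 0ℚ
fromNat-≢0 {a} a≢0 eq with *≡* p ← fromℚᵘ-injective {mkℚᵘ (+ a) 0} {mkℚᵘ (+ 0) 0} eq =
  a≢0 (ℤₚ.+-injective (trans (sym (ℤₚ.*-identityʳ (+ a))) p))

1/-fromNat : ∀ k → + 1 / suc k * fromNat (suc k) ≡ 1ℚ
1/-fromNat k = trans (fromℚᵘ-homo-* (mkℚᵘ (+ 1) k) (mkℚᵘ (+ suc k) 0))
  (fromℚᵘ-cong {mkℚᵘ (+ 1) k ℚᵘ.* mkℚᵘ (+ suc k) 0} {ℚᵘ.1ℚᵘ} (*≡* (eq (+ suc k))))
  where
  eq : ∀ i → + 1 ℤ.* i ℤ.* + 1 ≡ + 1 ℤ.* (i ℤ.* + 1)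
  eq = ℤ-solve-∀

neg-fromNat : ∀ n → - fromNat n ≡ (ℤ.- + n) / 1
neg-fromNat zero    = refl
neg-fromNat (suc n) = refl

*-cancelʳ-≢0 : ∀ {p q} r → r ≢ 0ℚ → p * r ≡ q * r → p ≡ q
*-cancelʳ-≢0 {p} {q} r r≢0 eq = begin
  p                 ≡⟨ divide p ⟨
  p * r * 1/ r      ≡⟨ cong (_* 1/ r) eq ⟩
  q * r * 1/ r      ≡⟨ divide q ⟩
  q                 ∎
  where
  instance _ = ≢-nonZero r≢0
  divide : ∀ p → p * r * 1/ r ≡ p
  divide p = trans (*-assoc p r (1/ r)) (trans (cong (p *_) (*-inverseʳ r)) (*-identityʳ p))

÷₀-* : ∀ p {q} → q ≢ 0ℚ → (p ÷₀ q) * q ≡ p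
÷₀-* p {q} q≢0 with q ≟ 0ℚ
... | yes q≡0 = contradiction q≡0 q≢0
... | no  q≢0 = trans (*-assoc p (1/ q) q) (trans (cong (p *_) (*-inverseˡ q)) (*-identityʳ p))
  where instance _ = ≢-nonZero q≢0

÷₀-zero : ∀ p {q} → q ≡ 0ℚ → p ÷₀ q ≡ 0ℚ
÷₀-zero p {q} q≡0 with q ≟ 0ℚ
... | yes _   = refl
... | no  q≢0 = contradiction q≡0 q≢0

-- Pochhammer symbols.

-- The factor -n + k is -(n ∸ k) as long as k ≤ n. It is zero at k = n, so both sides stay zero
-- afterwards.
poch-neg : ∀ n k → poch (- fromNat n) k ≡ (- 1ℚ) ^ k * fromNat (falling n k)
poch-neg n zero    = refl
poch-neg n (suc k) with ℕₚ.≤-<-connex k n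
... | inj₁ k≤n = begin
  poch (- fromNat n) k * (- fromNat n + fromNat k)
    ≡⟨ cong₂ (λ x y → x * (- y + fromNat k)) (poch-neg n k)
         (trans (cong fromNat (sym (ℕₚ.m∸n+n≡m k≤n))) (fromNat-+ (n ∸ k) k)) ⟩
  s * f * (- (fromNat (n ∸ k) + fromNat k) + fromNat k)
    ≡⟨ solve 4 (λ s f d k → s :* f :* (:- (d :+ k) :+ k) := s :* (:- con 1ℚ) :* (d :* f)) refl
         s f (fromNat (n ∸ k)) (fromNat k) ⟩
  s * (- 1ℚ) * (fromNat (n ∸ k) * f)
    ≡⟨ cong (s * (- 1ℚ) *_) (fromNat-* (n ∸ k) (falling n k)) ⟨
  s * (- 1ℚ) * fromNat ((n ∸ k) ℕ.* falling n k)
    ≡⟨ cong (λ x → s * (- 1ℚ) * fromNat x) (falling-suc n k) ⟨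
  s * (- 1ℚ) * fromNat (falling n (suc k)) ∎
  where
  s = (- 1ℚ) ^ k
  f = fromNat (falling n k)
... | inj₂ n<k = begin
  poch (- fromNat n) k * r             ≡⟨ cong (_* r) (poch-neg n k) ⟩
  s * fromNat (falling n k) * r        ≡⟨ cong (λ x → s * fromNat x * r) (n<k⇒falling≡0 n<k) ⟩
  s * 0ℚ * r                           ≡⟨ solve 2 (λ s r → s :* con 0ℚ :* r := s :* (:- con 1ℚ) :* con 0ℚ) refl s r ⟩
  s * (- 1ℚ) * 0ℚ                      ≡⟨ cong (λ x → s * (- 1ℚ) * fromNat x) (n<k⇒falling≡0 (ℕₚ.m<n⇒m<1+n n<k)) ⟨
  s * (- 1ℚ) * fromNat (falling n (suc k)) ∎
  where
  s = (- 1ℚ) ^ k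
  r = - fromNat n + fromNat k

poch-2 : ∀ k → poch (fromNat 2) k ≡ fromNat (suc k !)
poch-2 zero    = refl
poch-2 (suc k) = begin
  poch (fromNat 2) k * (fromNat 2 + fromNat k)   ≡⟨ cong₂ _*_ (poch-2 k) (sym (fromNat-+ 2 k)) ⟩
  fromNat (suc k !) * fromNat (2 ℕ.+ k)          ≡⟨ fromNat-* (suc k !) (2 ℕ.+ k) ⟨
  fromNat (suc k ! ℕ.* (2 ℕ.+ k))                ≡⟨ cong fromNat (ℕₚ.*-comm (suc k !) (2 ℕ.+ k)) ⟩
  fromNat ((2 ℕ.+ k) !)                          ∎

-- Each new factor 4 doubles one linear factor from either symbol, giving the consecutive factors b
-- + 2k and b + 2k + 1. The halves enter only through `x + x` and `y + y`, so no fraction has to be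
-- evaluated.
poch-duplication : ∀ {x y b} → x + x ≡ b → y + y ≡ b + 1ℚ → ∀ k →
  fromNat 4 ^ k * (poch x k * poch y k) ≡ poch b (k ℕ.+ k)
poch-duplication         _  _  zero    = refl
poch-duplication {x} {y} {b} x+x y+y (suc k) rewrite ℕₚ.+-suc k k = begin
  z * fromNat 4 * (u * (x + K) * (v * (y + K)))
    ≡⟨ solve 6 (λ z u v x y K →
         z :* con (fromNat 4) :* (u :* (x :+ K) :* (v :* (y :+ K)))
           := z :* (u :* v) :* (x :+ x :+ (K :+ K)) :* (y :+ y :+ (K :+ K)))
         refl z u v x y K ⟩
  z * (u * v) * (x + x + (K + K)) * (y + y + (K + K))
    ≡⟨ cong₂ _*_ (cong₂ _*_ (poch-duplication x+x y+y k) (cong₂ _+_ x+x (sym (fromNat-+ k k))))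
         (trans (cong₂ _+_ y+y (sym (fromNat-+ k k))) (+-assoc b 1ℚ _)) ⟩
  poch b (k ℕ.+ k) * (b + fromNat (k ℕ.+ k)) * (b + (1ℚ + fromNat (k ℕ.+ k)))
    ≡⟨ cong (λ w → poch b (k ℕ.+ k) * (b + fromNat (k ℕ.+ k)) * (b + w)) (fromNat-+ 1 (k ℕ.+ k)) ⟨
  poch b (k ℕ.+ k) * (b + fromNat (k ℕ.+ k)) * (b + fromNat (suc (k ℕ.+ k))) ∎
  where
  z = fromNat 4 ^ k
  u = poch x k
  v = poch y k
  K = fromNat k

[-1]^-square : ∀ k → (- 1ℚ) ^ k * (- 1ℚ) ^ k ≡ 1ℚ
[-1]^-square zero    = refl
[-1]^-square (suc k) = trans
  (solve 1 (λ s → s :* (:- con 1ℚ) :* (s :* (:- con 1ℚ)) := s :* s) refl ((- 1ℚ) ^ k))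
  ([-1]^-square k)

[-1]^-double : ∀ k → (- 1ℚ) ^ (k ℕ.+ k) ≡ 1ℚ
[-1]^-double zero    = refl
[-1]^-double (suc k) rewrite ℕₚ.+-suc k k = trans
  (solve 1 (λ s → s :* (:- con 1ℚ) :* (:- con 1ℚ) := s) refl ((- 1ℚ) ^ (k ℕ.+ k)))
  ([-1]^-double k)

-- Coefficients of sums of monomials.

t^-≡ : ∀ {j k} → k ≡ j → (t^ j) k ≡ 1ℚ
t^-≡ {j} {k} k≡j with k ℕ.≟ j
... | yes _  = refl
... | no k≢j = contradiction k≡j k≢j

t^-≢ : ∀ {j k} → k ≢ j → (t^ j) k ≡ 0ℚ
t^-≢ {j} {k} k≢j with k ℕ.≟ j
... | yes k≡j = contradiction k≡j k≢j
... | no _    = refl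

∑-t^asc : ∀ {m} k (ws : List (Vec ℕ (suc m))) →
  ∑ (map (λ w → t^ asc w) ws) k ≡ fromNat (#asc k ws)
∑-t^asc k []       = refl
-- `t^_` decides `k ≟ asc w` but `#asc` decides `asc w ≟ k`; a single decision is passed on and
-- transferred to each.
∑-t^asc k (w ∷ ws) = head-term (k ℕ.≟ asc w)
  where
  head-term : Dec (k ≡ asc w) → (t^ asc w) k + ∑ (map (λ w → t^ asc w) ws) k ≡ fromNat (#asc k (w ∷ ws))
  head-term (yes k≡) = begin
    (t^ asc w) k + ∑ (map (λ w → t^ asc w) ws) k  ≡⟨ cong₂ _+_ (t^-≡ k≡) (∑-t^asc k ws) ⟩
    fromNat 1 + fromNat (#asc k ws)               ≡⟨ fromNat-+ 1 (#asc k ws) ⟨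
    fromNat (suc (#asc k ws))
      ≡⟨ cong (λ vs → fromNat (length vs)) (Listₚ.filter-accept (λ w → asc w ℕ.≟ k) {x = w} (sym k≡)) ⟨
    fromNat (#asc k (w ∷ ws))                     ∎
  head-term (no k≢) = begin
    (t^ asc w) k + ∑ (map (λ w → t^ asc w) ws) k  ≡⟨ cong₂ _+_ (t^-≢ k≢) (∑-t^asc k ws) ⟩
    0ℚ + fromNat (#asc k ws)                      ≡⟨ +-identityˡ _ ⟩
    fromNat (#asc k ws)
      ≡⟨ cong (λ vs → fromNat (length vs)) (Listₚ.filter-reject (λ w → asc w ℕ.≟ k) {x = w} (k≢ ∘ sym)) ⟨
    fromNat (#asc k (w ∷ ws))                     ∎

ascRP-coefficient : ∀ m k → ascRP (suc m) k ≡ fromNat (#paths m 0 k)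
ascRP-coefficient m k = trans (∑-t^asc k (RP m))
  (cong fromNat (↭-length (filter-↭ (λ w → asc w ℕ.≟ k) (RP↭paths m))))

module _ (g : ℕ → ℚ) where

  private
    -- The exponent shift makes `∑[1⋯ N ]` unfold to `polynomial (upTo N)`.
    polynomial : List ℕ → ℚ[[t]]
    polynomial js = ∑ (map (λ j → g j · (t^ suc j)) js)

    skip : ∀ {j k} js → k ≢ suc j → polynomial (j ∷ js) k ≡ polynomial js k
    skip {j} js k≢ = trans
      (cong (λ x → g j * x + polynomial js _) (t^-≢ k≢))
      (trans (cong (_+ polynomial js _) (*-zeroʳ (g j))) (+-identityˡ _))

  ∑-coefficient-zero : ∀ js → polynomial js 0 ≡ 0ℚ
  ∑-coefficient-zero []       = refl
  ∑-coefficient-zero (j ∷ js) = trans (skip js λ ()) (∑-coefficient-zero js)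

  ∑-coefficient-∉ : ∀ {k js} → k ∉ js → polynomial js (suc k) ≡ 0ℚ
  ∑-coefficient-∉ {js = []}     _  = refl
  ∑-coefficient-∉ {js = j ∷ js} k∉ = trans
    (skip js (k∉ ∘ here ∘ ℕₚ.suc-injective)) (∑-coefficient-∉ (k∉ ∘ there))

  ∑-coefficient-∈ : ∀ {k js} → Unique js → k ∈ js → polynomial js (suc k) ≡ g k
  ∑-coefficient-∈ {k} {j ∷ js} (j∉ ∷ _) (here refl) = begin
    g k * (t^ suc k) (suc k) + polynomial js (suc k)
      ≡⟨ cong₂ (λ x y → g k * x + y) (t^-≡ {suc k} refl) (∑-coefficient-∉ (λ k∈ → All.lookup j∉ k∈ refl)) ⟩
    g k * 1ℚ + 0ℚ  ≡⟨ +-identityʳ _ ⟩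
    g k * 1ℚ       ≡⟨ *-identityʳ (g k) ⟩
    g k            ∎
  ∑-coefficient-∈ {k} {j ∷ js} (j∉ ∷ u) (there k∈) = trans
    (skip js (All.lookup j∉ k∈ ∘ sym ∘ ℕₚ.suc-injective)) (∑-coefficient-∈ u k∈)

-- The binomial form.

n<k+k⇒[n∸k]Ck≡0 : ∀ {n k} → n < k ℕ.+ k → (n ∸ k) C k ≡ 0
n<k+k⇒[n∸k]Ck≡0 {n} {k@(suc _)} n<k+k = k>n⇒nCk≡0 (ℕₚ.m<n+o⇒m∸n<o n k n<k+k)

⌊n/2⌋<k⇒n<k+k : ∀ {n k} → ⌊ n /2⌋ < k → n < k ℕ.+ k
⌊n/2⌋<k⇒n<k+k {n} {k} n/2<k = ℕₚ.≰⇒> λ k+k≤n →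
  ℕₚ.<⇒≱ n/2<k (subst (_≤ ⌊ n /2⌋) (sym (ℕₚ.n≡⌊n+n/2⌋ k)) (ℕₚ.⌊n/2⌋-mono k+k≤n))

-- Read off from the product formula after cancelling `suc k`. It ends the binomial sum, and also
-- the hypergeometric series where a denominator vanishes.
n<k+k⇒#paths≡0 : ∀ {M k} → M < k ℕ.+ k → #paths (2 ℕ.+ M) 0 (suc k) ≡ 0
n<k+k⇒#paths≡0 {M} {k} M<k+k = ℕₚ.*-cancelˡ-≡ _ 0 (suc k) (begin
  suc k ℕ.* #paths (2 ℕ.+ M) 0 (suc k)       ≡⟨ [1+k]*#paths M k ⟩
  ((2 ℕ.+ M) C k) ℕ.* ((M ∸ k) C k)          ≡⟨ cong (((2 ℕ.+ M) C k) ℕ.*_) (n<k+k⇒[n∸k]Ck≡0 {M} {k} M<k+k) ⟩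
  ((2 ℕ.+ M) C k) ℕ.* 0                      ≡⟨ ℕₚ.*-zeroʳ ((2 ℕ.+ M) C k) ⟩
  0                                          ≡⟨ ℕₚ.*-zeroʳ (suc k) ⟨
  suc k ℕ.* 0                                ∎)

-- The coefficient of the summand for size n = 3 + M at i = `suc k`, with the truncated differences
-- already reduced.
binomialTerm : ℕ → ℕ → ℚ
binomialTerm M k = + 1 / suc k * fromNat ((2 ℕ.+ M) C k) * fromNat ((M ∸ k) C k)

binomialTerm≡#paths : ∀ M k → binomialTerm M k ≡ fromNat (#paths (2 ℕ.+ M) 0 (suc k))
binomialTerm≡#paths M k = begin
  r * fromNat a * fromNat b          ≡⟨ *-assoc r _ _ ⟩
  r * (fromNat a * fromNat b)        ≡⟨ cong (r *_) (fromNat-* a b) ⟨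
  r * fromNat (a ℕ.* b)              ≡⟨ cong (λ x → r * fromNat x) ([1+k]*#paths M k) ⟨
  r * fromNat (suc k ℕ.* c)          ≡⟨ cong (r *_) (fromNat-* (suc k) c) ⟩
  r * (fromNat (suc k) * fromNat c)  ≡⟨ *-assoc r _ _ ⟨
  r * fromNat (suc k) * fromNat c    ≡⟨ cong (_* fromNat c) (1/-fromNat k) ⟩
  1ℚ * fromNat c                     ≡⟨ *-identityˡ (fromNat c) ⟩
  fromNat c                          ∎
  where
  r = + 1 / suc k
  a = (2 ℕ.+ M) C k
  b = (M ∸ k) C k
  c = #paths (2 ℕ.+ M) 0 (suc k)

-- The upper limit is `⌊ 2 + M /2⌋` computed one step. Within it exactly one monomial meets a given
-- positive exponent; beyond it the path count vanishes.
ascRP-binomial : ∀ M → ascRP (3 ℕ.+ M) ≈ ∑[1⋯ suc ⌊ M /2⌋ ]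
  (λ i → (+ 1 / i * fromNat ((2 ℕ.+ M) C (i ∸ 1)) * fromNat ((suc M ∸ i) C (i ∸ 1))) · (t^ i))
ascRP-binomial M zero    = begin
  ascRP (3 ℕ.+ M) 0                ≡⟨ ascRP-coefficient (2 ℕ.+ M) 0 ⟩
  fromNat (#paths (2 ℕ.+ M) 0 0)   ≡⟨ cong fromNat (#paths-suc-zero-zero (suc M)) ⟩
  0ℚ                               ≡⟨ ∑-coefficient-zero (binomialTerm M) (upTo (suc ⌊ M /2⌋)) ⟨
  _                                ∎
ascRP-binomial M (suc k) with ℕₚ.<-≤-connex k (suc ⌊ M /2⌋)
... | inj₁ k≤M/2 = begin
  ascRP (3 ℕ.+ M) (suc k)                ≡⟨ ascRP-coefficient (2 ℕ.+ M) (suc k) ⟩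
  fromNat (#paths (2 ℕ.+ M) 0 (suc k))   ≡⟨ binomialTerm≡#paths M k ⟨
  binomialTerm M k                               ≡⟨ ∑-coefficient-∈ (binomialTerm M) (Uniqueₚ.upTo⁺ (suc ⌊ M /2⌋)) (∈ₚ.∈-upTo⁺ k≤M/2) ⟨
  _                                      ∎
... | inj₂ M/2<k = begin
  ascRP (3 ℕ.+ M) (suc k)                ≡⟨ ascRP-coefficient (2 ℕ.+ M) (suc k) ⟩
  fromNat (#paths (2 ℕ.+ M) 0 (suc k))   ≡⟨ cong fromNat (n<k+k⇒#paths≡0 (⌊n/2⌋<k⇒n<k+k M/2<k)) ⟩
  0ℚ                                     ≡⟨ ∑-coefficient-∉ (binomialTerm M) {js = upTo (suc ⌊ M /2⌋)} (ℕₚ.≤⇒≯ M/2<k ∘ ∈ₚ.∈-upTo⁻) ⟨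
  _                                      ∎

-- The hypergeometric form.

module _ (M k : ℕ) {a₂ a₃ : ℚ}
  (a₂+a₂ : a₂ + a₂ ≡ - fromNat M) (a₃+a₃ : a₃ + a₃ ≡ - fromNat M + 1ℚ) where

  private
    m   = 2 ℕ.+ M
    c   = #paths m 0 (suc k)
    s   = (- 1ℚ) ^ k
    fM  = falling M k
    z   = fromNat 4 ^ k
    numerator   = poch (- fromNat m) k * poch a₂ k * poch a₃ k
    denominator = poch (fromNat 2) k * poch (- fromNat M) k

    denominator≡ : denominator ≡ fromNat (suc k !) * (s * fromNat fM)
    denominator≡ = cong₂ _*_ (poch-2 k) (poch-neg M k)

    -- Duplication absorbs the powers of 4 and leaves (-M)_2k, whose sign is +1. The surviving sign
    -- `s` of (-m)_k also occurs in the denominator.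
    numerator≡ : numerator * z ≡ s * fromNat (falling m k ℕ.* (fM ℕ.* falling (M ∸ k) k))
    numerator≡ = begin
      poch (- fromNat m) k * u * v * z
        ≡⟨ solve 4 (λ p u v z → p :* u :* v :* z := p :* (z :* (u :* v))) refl (poch (- fromNat m) k) u v z ⟩
      poch (- fromNat m) k * (z * (u * v))
        ≡⟨ cong₂ _*_ (poch-neg m k) (trans (poch-duplication a₂+a₂ a₃+a₃ k) (poch-neg M (k ℕ.+ k))) ⟩
      s * fromNat (falling m k) * ((- 1ℚ) ^ (k ℕ.+ k) * fromNat (falling M (k ℕ.+ k)))
        ≡⟨ cong₂ (λ x y → s * fromNat (falling m k) * (x * fromNat y)) ([-1]^-double k) (falling-+ M k k) ⟩
      s * fromNat (falling m k) * (1ℚ * fromNat (fM ℕ.* falling (M ∸ k) k))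
        ≡⟨ cong (s * fromNat (falling m k) *_) (*-identityˡ _) ⟩
      s * fromNat (falling m k) * fromNat (fM ℕ.* falling (M ∸ k) k)
        ≡⟨ *-assoc s _ _ ⟩
      s * (fromNat (falling m k) * fromNat (fM ℕ.* falling (M ∸ k) k))
        ≡⟨ cong (s *_) (fromNat-* (falling m k) _) ⟨
      s * fromNat (falling m k ℕ.* (fM ℕ.* falling (M ∸ k) k)) ∎
      where
      u = poch a₂ k
      v = poch a₃ k

    -- The coefficient identity cleared of signs and denominators: the product formula multiplied by
    -- `k ! * fM * k !`.
    falling-#paths : falling m k ℕ.* (fM ℕ.* falling (M ∸ k) k) ≡ c ℕ.* (suc k ! ℕ.* fM ℕ.* k !)
    falling-#paths = begin
      k ! ℕ.* a ℕ.* (fM ℕ.* (k ! ℕ.* b))      ≡⟨ regroup₁ (k !) a fM b ⟩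
      a ℕ.* b ℕ.* (k ! ℕ.* fM ℕ.* k !)        ≡⟨ cong (ℕ._* (k ! ℕ.* fM ℕ.* k !)) ([1+k]*#paths M k) ⟨
      suc k ℕ.* c ℕ.* (k ! ℕ.* fM ℕ.* k !)    ≡⟨ regroup₂ k c (k !) fM ⟩
      c ℕ.* (suc k ℕ.* k ! ℕ.* fM ℕ.* k !)    ∎
      where
      a = m C k
      b = (M ∸ k) C k
      regroup₁ : ∀ x a f b → x ℕ.* a ℕ.* (f ℕ.* (x ℕ.* b)) ≡ a ℕ.* b ℕ.* (x ℕ.* f ℕ.* x)
      regroup₁ = solve-∀
      regroup₂ : ∀ k c x f → suc k ℕ.* c ℕ.* (x ℕ.* f ℕ.* x) ≡ c ℕ.* (suc k ℕ.* x ℕ.* f ℕ.* x)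
      regroup₂ = solve-∀

    k!≢0 : ∀ k → fromNat (k !) ≢ 0ℚ
    k!≢0 k = fromNat-≢0 (ℕ.≢-nonZero⁻¹ (k !) {{k ℕₚ.!≢0}})

  -- Past `M` the symbol (-M)_k is zero, so `_÷₀_` returns its default 0; the count is 0 as well
  -- because M < k ≤ 2k.
  ₃F₂-coefficient-> : M < k →
    ₃F₂[ - fromNat m , a₂ , a₃ ⨾ fromNat 2 , - fromNat M ⨾ fromNat 4 t] k ≡ fromNat c
  ₃F₂-coefficient-> M<k = begin
    (numerator ÷₀ denominator) * (z ÷₀ fromNat (k !))
      ≡⟨ cong (_* (z ÷₀ fromNat (k !))) (÷₀-zero numerator denominator≡0) ⟩
    0ℚ * (z ÷₀ fromNat (k !))
      ≡⟨ *-zeroˡ (z ÷₀ fromNat (k !)) ⟩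
    0ℚ
      ≡⟨ cong fromNat (n<k+k⇒#paths≡0 (ℕₚ.<-≤-trans M<k (ℕₚ.m≤m+n k k))) ⟨
    fromNat c ∎
    where
    denominator≡0 : denominator ≡ 0ℚ
    denominator≡0 = begin
      denominator                           ≡⟨ denominator≡ ⟩
      fromNat (suc k !) * (s * fromNat fM)  ≡⟨ cong (λ x → fromNat (suc k !) * (s * fromNat x)) (n<k⇒falling≡0 M<k) ⟩
      fromNat (suc k !) * (s * 0ℚ)          ≡⟨ cong (fromNat (suc k !) *_) (*-zeroʳ s) ⟩
      fromNat (suc k !) * 0ℚ                ≡⟨ *-zeroʳ (fromNat (suc k !)) ⟩
      0ℚ                                    ∎

  -- Both divisors are nonzero in this range, so the equation may be multiplied by them and reduces
  -- to `falling-#paths`.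
  ₃F₂-coefficient-≤ : k ≤ M →
    ₃F₂[ - fromNat m , a₂ , a₃ ⨾ fromNat 2 , - fromNat M ⨾ fromNat 4 t] k ≡ fromNat c
  ₃F₂-coefficient-≤ k≤M = *-cancelʳ-≢0 (fromNat (k !)) (k!≢0 k) (*-cancelʳ-≢0 denominator denominator≢0 (begin
    (numerator ÷₀ denominator) * (z ÷₀ K) * K * denominator
      ≡⟨ solve 4 (λ p q K d → p :* q :* K :* d := p :* d :* (q :* K)) refl
           (numerator ÷₀ denominator) (z ÷₀ K) K denominator ⟩
    (numerator ÷₀ denominator) * denominator * ((z ÷₀ K) * K)
      ≡⟨ cong₂ _*_ (÷₀-* numerator denominator≢0) (÷₀-* z (k!≢0 k)) ⟩
    numerator * z
      ≡⟨ numerator≡ ⟩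
    s * fromNat (falling m k ℕ.* (fM ℕ.* falling (M ∸ k) k))
      ≡⟨ cong (λ x → s * fromNat x) falling-#paths ⟩
    s * fromNat (c ℕ.* (suc k ! ℕ.* fM ℕ.* k !))
      ≡⟨ cong (s *_) (fromNat-* c (suc k ! ℕ.* fM ℕ.* k !)) ⟩
    s * (fromNat c * fromNat (suc k ! ℕ.* fM ℕ.* k !))
      ≡⟨ cong (λ x → s * (fromNat c * x)) (trans (fromNat-* (suc k ! ℕ.* fM) (k !)) (cong (_* K) (fromNat-* (suc k !) fM))) ⟩
    s * (fromNat c * (fromNat (suc k !) * fromNat fM * K))
      ≡⟨ solve 5 (λ s c x f K → s :* (c :* (x :* f :* K)) := c :* K :* (x :* (s :* f))) refl
           s (fromNat c) (fromNat (suc k !)) (fromNat fM) K ⟩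
    fromNat c * K * (fromNat (suc k !) * (s * fromNat fM))
      ≡⟨ cong (fromNat c * K *_) denominator≡ ⟨
    fromNat c * K * denominator ∎))
    where
    K = fromNat (k !)

    -- Multiplying by the sign s turns the denominator into a positive integer.
    denominator≢0 : denominator ≢ 0ℚ
    denominator≢0 d≡0 = fromNat-≢0 {suc k ! ℕ.* fM} positive (begin
      fromNat (suc k ! ℕ.* fM)                    ≡⟨ fromNat-* (suc k !) fM ⟩
      fromNat (suc k !) * fromNat fM              ≡⟨ *-identityˡ _ ⟨
      1ℚ * (fromNat (suc k !) * fromNat fM)       ≡⟨ cong (_* (fromNat (suc k !) * fromNat fM)) ([-1]^-square k) ⟨
      s * s * (fromNat (suc k !) * fromNat fM)    ≡⟨ solve 3 (λ s x f → s :* s :* (x :* f) := x :* (s :* f) :* s) refl s (fromNat (suc k !)) (fromNat fM) ⟩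
      fromNat (suc k !) * (s * fromNat fM) * s    ≡⟨ cong (_* s) (trans (sym denominator≡) d≡0) ⟩
      0ℚ * s                                      ≡⟨ *-zeroˡ s ⟩
      0ℚ                                          ∎)
      where
      positive : suc k ! ℕ.* fM ≢ 0
      positive eq with ℕₚ.m*n≡0⇒m≡0∨n≡0 (suc k !) eq
      ... | inj₁ k!≡0 = ℕ.≢-nonZero⁻¹ (suc k !) {{suc k ℕₚ.!≢0}} k!≡0
      ... | inj₂ f≡0  = k≤n⇒falling≢0 k≤M f≡0

  ₃F₂-coefficient :
    ₃F₂[ - fromNat m , a₂ , a₃ ⨾ fromNat 2 , - fromNat M ⨾ fromNat 4 t] k ≡ fromNat c
  ₃F₂-coefficient = [ ₃F₂-coefficient-≤ , ₃F₂-coefficient-> ]′ (ℕₚ.≤-<-connex k M)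

ascRP-hypergeometric : ∀ M → let n = 3 ℕ.+ M in
  ascRP n ≈ t* ₃F₂[ (+ 1 ℤ.- + n) / 1 , (+ 3 ℤ.- + n) / 2 , (+ 4 ℤ.- + n) / 2 ⨾ fromNat 2 , (+ 3 ℤ.- + n) / 1 ⨾ fromNat 4 t]
ascRP-hypergeometric M zero    =
  trans (ascRP-coefficient (2 ℕ.+ M) 0) (cong fromNat (#paths-suc-zero-zero (suc M)))
ascRP-hypergeometric M (suc k) = begin
  ascRP n (suc k)
    ≡⟨ ascRP-coefficient (2 ℕ.+ M) (suc k) ⟩
  fromNat (#paths (2 ℕ.+ M) 0 (suc k))
    ≡⟨ ₃F₂-coefficient M k a₂+a₂ a₃+a₃ ⟨
  ₃F₂[ - fromNat (2 ℕ.+ M) , a₂ , a₃ ⨾ fromNat 2 , - fromNat M ⨾ fromNat 4 t] k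
    ≡⟨ cong₂ (λ x y → ₃F₂[ x , a₂ , a₃ ⨾ fromNat 2 , y ⨾ fromNat 4 t] k) a₁≡ b₂≡ ⟨
  ₃F₂[ (+ 1 ℤ.- + n) / 1 , a₂ , a₃ ⨾ fromNat 2 , (+ 3 ℤ.- + n) / 1 ⨾ fromNat 4 t] k ∎
  where
  n  = 3 ℕ.+ M
  a₂ = (+ 3 ℤ.- + n) / 2
  a₃ = (+ 4 ℤ.- + n) / 2

  cancel : ∀ p m → + p ℤ.- + (p ℕ.+ m) ≡ ℤ.- + m
  cancel p m = trans (cong (λ x → + p ℤ.- x) (ℤₚ.pos-+ p m)) (eq (+ p) (+ m))
    where
    eq : ∀ i j → i ℤ.- (i ℤ.+ j) ≡ ℤ.- j
    eq = ℤ-solve-∀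

  a₁≡ : (+ 1 ℤ.- + n) / 1 ≡ - fromNat (2 ℕ.+ M)
  a₁≡ = trans (cong (_/ 1) (cancel 1 (2 ℕ.+ M))) (sym (neg-fromNat (2 ℕ.+ M)))

  b₂≡ : (+ 3 ℤ.- + n) / 1 ≡ - fromNat M
  b₂≡ = trans (cong (_/ 1) (cancel 3 M)) (sym (neg-fromNat M))

  a₂+a₂ : a₂ + a₂ ≡ - fromNat M
  a₂+a₂ = trans (/2-+ (+ 3 ℤ.- + n)) b₂≡

  a₃+a₃ : a₃ + a₃ ≡ - fromNat M + 1ℚ
  a₃+a₃ = begin
    a₃ + a₃                            ≡⟨ /2-+ (+ 4 ℤ.- + n) ⟩
    (+ 4 ℤ.- + n) / 1                  ≡⟨ cong (_/ 1) (eq (+ n)) ⟩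
    (+ 3 ℤ.- + n ℤ.+ + 1) / 1          ≡⟨ /1-+ (+ 3 ℤ.- + n) (+ 1) ⟨
    (+ 3 ℤ.- + n) / 1 + 1ℚ             ≡⟨ cong (_+ 1ℚ) b₂≡ ⟩
    - fromNat M + 1ℚ                   ∎
    where
    eq : ∀ i → + 4 ℤ.- i ≡ + 3 ℤ.- i ℤ.+ + 1
    eq = ℤ-solve-∀

theorem6p13 : ∀ (n : ℕ) → 2 ≤ n →
    (ascRP n ≈ ∑[1⋯ ⌊ n ∸ 1 /2⌋ ] (λ i → ((+ 1 / i) * fromNat ((n ∸ 1) C (i ∸ 1)) * fromNat ((n ∸ 2 ∸ i) C (i ∸ 1))) · (t^ i)))
    × (3 ≤ n → ascRP n ≈ t* ₃F₂[ (+ 1 ℤ.- + n) / 1 , (+ 3 ℤ.- + n) / 2 , (+ 4 ℤ.- + n) / 2 ⨾ fromNat 2 , (+ 3 ℤ.- + n) / 1 ⨾ fromNat 4 t])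
theorem6p13 (suc zero)          (s≤s ())
-- At size 2 there is no sequence and `⌊ 1 /2⌋` is 0, so both sides are empty sums.
theorem6p13 (suc (suc zero))    _ = (λ _ → refl) , λ { (s≤s (s≤s ())) }
theorem6p13 (suc (suc (suc M))) _ = ascRP-binomial M , λ _ → ascRP-hypergeometric M
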